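{- Let $n\ge2$. Let $A_1=\{1\text{ - }23\}$, $A_2=\{2\text{ - }13,21\text{ - }3\}$, $A_3=\{2\text{ - }31,23\text{ - }1\}$, $A_4=\{3\text{ - }12,31\text{ - }2\}$. For every choice of $p_i\in A_i$ ($i=1,2,3,4$), $|S_n(p_1,p_2,p_3,p_4)|=2$ and $$S_n(p_1,p_2,p_3,p_4)=\{\,n\,(n-1)\ldots 1,\ \ 1\,n\,(n-1)\ldots 3\,2\,\}.$$
   Context: $S_n$ is the set of permutations $\pi=\pi_1\pi_2\cdots\pi_n$ of $\{1,\dots,n\}$ (written in one-line notation). For $abc$ a permutation of $123$, the generalized pattern $a\text{ - }bc$ is contained in $\pi$ if there are indices $i<j$ with $j+1\le n$ such that $\pi_i\pi_j\pi_{j+1}$ is order-isomorphic to $abc$; the generalized pattern $ab\text{ - }c$ is contained in $\pi$ if there are indices $i,k$ with $i+1<k\le n$ such that $\pi_i\pi_{i+1}\pi_k$ is order-isomorphic to $abc$. $\pi$ avoids a pattern if it does not contain it. $S_n(p_1,\dots,p_m)$ is the set of $\pi\in S_n$ avoiding all of $p_1,\dots,p_m$. -}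

module Defs where

open import Data.Nat.Base using (ℕ; zero; suc; _<_)
open import Data.Fin.Base as Fin using (Fin; toℕ)
open import Data.Fin.Permutation using (Permutation′; _⟨$⟩ʳ_; _≈_; id; reverse; lift₀)
open import Data.List.Base using (List)
open import Data.List.Relation.Unary.All using (All)
open import Data.Product.Base using (∃-syntax; _×_; proj₁)
open import Data.Sum.Base using (_⊎_)
open import Data.Vec.Base using (Vec; []; _∷_; lookup)
open import Function.Bundles using (_⇔_; Inverse)
open import Level using (0ℓ)
open import Relation.Binary.Bundles using (Setoid)
import Relation.Binary.Construct.On as On
open import Relation.Binary.PropositionalEquality using (_≡_; setoid; _→-setoid_)
open import Relation.Nullary.Negation using (¬_)
open import Relation.Unary using (Pred)

-- Permutations of {1,…,n} are represented by the library's permutations of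
-- Fin n, with positions and values both shifted down by one, and are compared
-- by the library's pointwise equality _≈_.

OrderIsomorphic : ∀ {k} → Vec ℕ k → Vec ℕ k → Set
OrderIsomorphic u v = ∀ s t → (lookup u s < lookup u t) ⇔ (lookup v s < lookup v t)

-- [ a - b ∙ c ] is the generalized pattern a-bc and [ a ∙ b - c ] is ab-c:
-- letters joined by ∙ must occur in adjacent positions.  The letters a, b, c
-- are meant to be a rearrangement of 1, 2, 3.
data Pattern : Set where
  [_-_∙_] : (a b c : ℕ) → Pattern
  [_∙_-_] : (a b c : ℕ) → Pattern

module _ {n : ℕ} (π : Permutation′ n) where

  private
    value : Fin n → ℕ
    value i = toℕ (π ⟨$⟩ʳ i)

  Contains : Pattern → Set
  Contains [ a - b ∙ c ] =
    ∃[ i ] ∃[ j ] ∃[ j⁺ ] i Fin.< j × toℕ j⁺ ≡ suc (toℕ j) ×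
      OrderIsomorphic (value i ∷ value j ∷ value j⁺ ∷ []) (a ∷ b ∷ c ∷ [])
  Contains [ a ∙ b - c ] =
    ∃[ i ] ∃[ i⁺ ] ∃[ k ] toℕ i⁺ ≡ suc (toℕ i) × i⁺ Fin.< k ×
      OrderIsomorphic (value i ∷ value i⁺ ∷ value k ∷ []) (a ∷ b ∷ c ∷ [])

  Avoids : Pattern → Set
  Avoids p = ¬ Contains p

S : (n : ℕ) → List Pattern → Pred (Permutation′ n) 0ℓ
S n ps π = All (Avoids π) ps

permutationSetoid : ℕ → Setoid 0ℓ 0ℓ
permutationSetoid n = On.setoid (Fin n →-setoid Fin n) _⟨$⟩ʳ_

-- Elements are identified when their underlying permutations are ≈, whatever
-- their proofs of membership.
subsetSetoid : ∀ {n} → Pred (Permutation′ n) 0ℓ → Setoid 0ℓ 0ℓ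
subsetSetoid {n} P = On.setoid (permutationSetoid n) (proj₁ {B = P})

HasCardinality : ∀ {n} → Pred (Permutation′ n) 0ℓ → ℕ → Set
HasCardinality P k = Inverse (setoid (Fin k)) (subsetSetoid P)

｛_,_｝ : ∀ {n} → Permutation′ n → Permutation′ n → Pred (Permutation′ n) 0ℓ
｛ σ , τ ｝ π = π ≈ σ ⊎ π ≈ τ

-- n (n-1) … 1
decreasing : ∀ n → Permutation′ n
decreasing n = reverse

-- 1 n (n-1) … 3 2; the value at n = 0 is a dummy.
oneThenDecreasing : ∀ n → Permutation′ n
oneThenDecreasing zero    = id
oneThenDecreasing (suc m) = lift₀ reverse

A₁ A₂ A₃ A₄ : Pred Pattern 0ℓ
A₁ p = p ≡ [ 1 - 2 ∙ 3 ]
A₂ p = p ≡ [ 2 - 1 ∙ 3 ] ⊎ p ≡ [ 2 ∙ 1 - 3 ]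
A₃ p = p ≡ [ 2 - 3 ∙ 1 ] ⊎ p ≡ [ 2 ∙ 3 - 1 ]
A₄ p = p ≡ [ 3 - 1 ∙ 2 ] ⊎ p ≡ [ 3 ∙ 1 - 2 ]

{-# OPTIONS --safe #-}

-- Three consecutive letters ordered as 123, 213 or 312 are an occurrence of every
-- pattern in A₁, A₂ or A₄ respectively, so avoidance makes every step other than
-- the first a descent.  If the first step is a descent too, the
-- permutation is decreasing.  If it is an ascent, the first letter must be the
-- minimum: otherwise the first letter below it, the letter before that one (for
-- 2-31) or the second letter (for 23-1), and the head form an occurrence of a
-- pattern in A₃.  Conversely, in both permutations the smaller letter of any
-- ascent is the minimum and comes first, which no occurrence of the patterns allows.

module Submission where

open import Defs
open import Data.Fin.Base as Fin using (Fin; zero; suc; toℕ; inject₁; opposite)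
open import Data.Fin.Induction using (<-weakInduction)
open import Data.Fin.Patterns using (0F; 1F; 2F)
open import Data.Fin.Permutation using (Permutation′; _⟨$⟩ʳ_; _⟨$⟩ˡ_; _≈_; inverseʳ; lift₀-remove; remove)
import Data.Fin.Properties as Fin
open import Data.List.Base using ([]; _∷_)
open import Data.List.Relation.Unary.All using ([]; _∷_)
open import Data.Nat.Base using (ℕ; zero; suc; _+_; _∸_; _≤_; _<_; z≤n; s≤s; z<s; s<s; s<s⁻¹)
open import Data.Nat.Properties
open import Data.Product.Base using (_×_; _,_; proj₁; proj₂; ∃-syntax)
open import Data.Sum.Base using (_⊎_; inj₁; inj₂)
open import Data.Vec.Base using (Vec; []; _∷_; lookup; tabulate)
open import Data.Vec.Properties using (lookup∘tabulate)
open import Function.Base using (_∘_)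
open import Function.Bundles using (Equivalence; Injection; mk⇔)
open import Function.Properties.Inverse using (↔⇒↣)
open import Level using (0ℓ)
open import Relation.Binary.Definitions using (tri<; tri≈; tri>)
open import Relation.Binary.PropositionalEquality
  using (_≡_; refl; sym; trans; cong; subst; subst₂; module ≡-Reasoning)
open import Relation.Nullary.Negation using (¬_; contradiction)
open import Relation.Unary using (Pred; _∈_; _≐_)

private
  variable
    k n : ℕ

-- Order isomorphism and occurrences of three-letter patterns

value : Permutation′ n → Fin n → ℕ
value π i = toℕ (π ⟨$⟩ʳ i)

value-injective : ∀ (π : Permutation′ n) {i j} → value π i ≡ value π j → i ≡ j
value-injective π = Injection.injective (↔⇒↣ π) ∘ Fin.toℕ-injective

StrictlyIncreasing : Vec ℕ k → Set
StrictlyIncreasing u = ∀ {s t} → s Fin.< t → lookup u s < lookup u t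

increasing-reflects-< : ∀ {u : Vec ℕ k} → StrictlyIncreasing u →
                        ∀ {s t} → lookup u s < lookup u t → s Fin.< t
increasing-reflects-< u↗ {s} {t} us<ut with Fin.<-cmp s t
... | tri< s<t _    _   = s<t
... | tri≈ _   refl _   = contradiction us<ut (n≮n _)
... | tri> _   _    t<s = contradiction us<ut (<-asym (u↗ t<s))

-- Comparing two entries on either side amounts to comparing the same two indices of `σ`, as both
-- `u` and `v` preserve and reflect order. For a concrete `σ` both `tabulate` terms compute to
-- explicit vectors, so the result applies directly to an occurrence.
increasing⇒orderIsomorphic :
  ∀ {u v : Vec ℕ k} → StrictlyIncreasing u → StrictlyIncreasing v →
  ∀ {m} (σ : Vec (Fin k) m) →
  OrderIsomorphic (tabulate (lookup u ∘ lookup σ)) (tabulate (lookup v ∘ lookup σ))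
increasing⇒orderIsomorphic {u = u} {v} u↗ v↗ σ s t
  rewrite lookup∘tabulate (lookup u ∘ lookup σ) s
        | lookup∘tabulate (lookup u ∘ lookup σ) t
        | lookup∘tabulate (lookup v ∘ lookup σ) s
        | lookup∘tabulate (lookup v ∘ lookup σ) t
  = mk⇔ (v↗ ∘ increasing-reflects-< {u = u} u↗) (u↗ ∘ increasing-reflects-< {u = v} v↗)

chain-increasing : ∀ {x y z} → x < y → y < z → StrictlyIncreasing (x ∷ y ∷ z ∷ [])
chain-increasing x<y y<z {0F} {1F} _ = x<y
chain-increasing x<y y<z {0F} {2F} _ = <-trans x<y y<z
chain-increasing x<y y<z {1F} {2F} _ = y<z
chain-increasing x<y y<z {1F} {1F} (s≤s ())
chain-increasing x<y y<z {2F} {1F} (s≤s ())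
chain-increasing x<y y<z {2F} {2F} (s≤s (s≤s ()))

chain-orderIsomorphic :
  ∀ {x y z} → x < y → y < z → (σ : Vec (Fin 3) 3) →
  OrderIsomorphic (tabulate (lookup (x ∷ y ∷ z ∷ []) ∘ lookup σ))
                  (tabulate (lookup (1 ∷ 2 ∷ 3 ∷ []) ∘ lookup σ))
chain-orderIsomorphic x<y y<z =
  increasing⇒orderIsomorphic {u = _ ∷ _ ∷ _ ∷ []} {_ ∷ _ ∷ _ ∷ []}
    (chain-increasing x<y y<z) (chain-increasing (n<1+n 1) (n<1+n 2))

letters : Pattern → Vec ℕ 3
letters [ a - b ∙ c ] = a ∷ b ∷ c ∷ []
letters [ a ∙ b - c ] = a ∷ b ∷ c ∷ []

A₁-letters : ∀ {p} → p ∈ A₁ → letters p ≡ 1 ∷ 2 ∷ 3 ∷ []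
A₁-letters refl = refl

A₂-letters : ∀ {p} → p ∈ A₂ → letters p ≡ 2 ∷ 1 ∷ 3 ∷ []
A₂-letters (inj₁ refl) = refl
A₂-letters (inj₂ refl) = refl

A₃-letters : ∀ {p} → p ∈ A₃ → letters p ≡ 2 ∷ 3 ∷ 1 ∷ []
A₃-letters (inj₁ refl) = refl
A₃-letters (inj₂ refl) = refl

A₄-letters : ∀ {p} → p ∈ A₄ → letters p ≡ 3 ∷ 1 ∷ 2 ∷ []
A₄-letters (inj₁ refl) = refl
A₄-letters (inj₂ refl) = refl

OccursAt : Permutation′ n → Vec ℕ 3 → Fin n → Fin n → Fin n → Set
OccursAt π v i j k = OrderIsomorphic (value π i ∷ value π j ∷ value π k ∷ []) v

-- Forgetting adjacency turns either kind of pattern into a classical one, so a single argument can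
-- show avoidance for both choices in each set.
contains⇒occurs : ∀ (π : Permutation′ n) p → Contains π p →
                  ∃[ i ] ∃[ j ] ∃[ k ] i Fin.< j × j Fin.< k × OccursAt π (letters p) i j k
contains⇒occurs π [ a - b ∙ c ] (i , j , j⁺ , i<j , j⁺≡1+j , occ) =
  i , j , j⁺ , i<j , ≤-reflexive (sym j⁺≡1+j) , occ
contains⇒occurs π [ a ∙ b - c ] (i , i⁺ , k , i⁺≡1+i , i⁺<k , occ) =
  i , i⁺ , k , ≤-reflexive (sym i⁺≡1+i) , i⁺<k , occ

-- Consecutive positions meet the adjacency condition of both kinds, whichever pair the pattern
-- glues together.
consecutive⇒contains : ∀ (π : Permutation′ n) p {v} → letters p ≡ v → ∀ {i j k} →
                       toℕ j ≡ suc (toℕ i) → toℕ k ≡ suc (toℕ j) →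
                       OccursAt π v i j k → Contains π p
consecutive⇒contains π [ a - b ∙ c ] refl j≡1+i k≡1+j occ =
  _ , _ , _ , ≤-reflexive (sym j≡1+i) , k≡1+j , occ
consecutive⇒contains π [ a ∙ b - c ] refl j≡1+i k≡1+j occ =
  _ , _ , _ , j≡1+i , ≤-reflexive (sym k≡1+j) , occ

-- The two members

-- An ascent here is any pair of positions, not only an adjacent one. The two conclusions, on
-- position and on value, each exclude different patterns.
AscendsOnlyFromMinimum : Permutation′ n → Set
AscendsOnlyFromMinimum π =
  ∀ {i j} → i Fin.< j → value π i < value π j → ∀ k → i Fin.≤ k × value π i ≤ value π k

opposite-anti-< : ∀ {i j : Fin n} → i Fin.< j → opposite j Fin.< opposite i
opposite-anti-< {n} {i} {j} i<j rewrite Fin.opposite-prop i | Fin.opposite-prop j =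
  ∸-monoʳ-< (s<s i<j) (Fin.toℕ<n j)

decreasing-ascends : ∀ n → AscendsOnlyFromMinimum (decreasing n)
decreasing-ascends n i<j vi<vj = contradiction vi<vj (<-asym (opposite-anti-< i<j))

oneThenDecreasing-ascends : ∀ n → AscendsOnlyFromMinimum (oneThenDecreasing n)
-- The head has position and value zero, so both bounds are trivial.
oneThenDecreasing-ascends (suc m) {zero}          _   _     _ = z≤n , z≤n
oneThenDecreasing-ascends (suc m) {suc i} {suc j} i<j vi<vj _ =
  contradiction (s<s⁻¹ vi<vj) (<-asym (opposite-anti-< (s<s⁻¹ i<j)))

ascends-resp-≈ : ∀ {π σ : Permutation′ n} → π ≈ σ →
                 AscendsOnlyFromMinimum σ → AscendsOnlyFromMinimum π
ascends-resp-≈ π≈σ asc {i} {j} i<j vi<vj k rewrite π≈σ i | π≈σ j | π≈σ k = asc i<j vi<vj k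

-- The last two letters form an ascent that starts after position `i`, against the bound on
-- positions. This handles 123, 213 and 312.
ascends⇒avoids-·<· : ∀ (π : Permutation′ n) → AscendsOnlyFromMinimum π → ∀ p {a b c} →
                     letters p ≡ a ∷ b ∷ c ∷ [] → b < c → Avoids π p
ascends⇒avoids-·<· π asc p eq b<c con
  with i , j , k , i<j , j<k , occ ← contains⇒occurs π p con
  rewrite eq
  = contradiction i<j (≤⇒≯ (proj₁ (asc j<k (Equivalence.from (occ 1F 2F) b<c) i)))

-- The first two letters form an ascent, so the first is the minimum and the third cannot lie below
-- it. This handles 231.
ascends⇒avoids-c<a<b : ∀ (π : Permutation′ n) → AscendsOnlyFromMinimum π → ∀ p {a b c} →
                       letters p ≡ a ∷ b ∷ c ∷ [] → a < b → c < a → Avoids π p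
ascends⇒avoids-c<a<b π asc p eq a<b c<a con
  with i , j , k , i<j , j<k , occ ← contains⇒occurs π p con
  rewrite eq
  = contradiction (Equivalence.from (occ 2F 0F) c<a)
      (≤⇒≯ (proj₂ (asc i<j (Equivalence.from (occ 0F 1F) a<b) k)))

-- Permutations with prescribed descents

-- Each step right lowers the value by at least one, so position plus value never exceeds its
-- initial amount.
descending⇒upper : (g : Fin (suc n) → ℕ) → (∀ i → g (suc i) < g (inject₁ i)) →
                   ∀ {b} → g zero ≤ b → ∀ i → toℕ i + g i ≤ b
descending⇒upper         g g↘ g0≤b zero    = g0≤b
descending⇒upper {suc n} g g↘ g0≤b (suc i) =
  ≤-trans (s≤s (descending⇒upper (g ∘ suc) (g↘ ∘ suc) ≤-refl i))
          (≤-trans (g↘ zero) g0≤b)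

-- From position `i` there remain `n ∸ toℕ i` strict descents, ending at a natural number.
descending⇒lower : (g : Fin (suc n) → ℕ) → (∀ i → g (suc i) < g (inject₁ i)) →
                   ∀ i → n ≤ toℕ i + g i
descending⇒lower {zero}  g g↘ i       = z≤n
descending⇒lower {suc n} g g↘ zero    =
  ≤-trans (s≤s (descending⇒lower (g ∘ suc) (g↘ ∘ suc) zero)) (g↘ zero)
descending⇒lower {suc n} g g↘ (suc i) = s≤s (descending⇒lower (g ∘ suc) (g↘ ∘ suc) i)

descending⇒≈decreasing : (π : Permutation′ (suc n)) →
                         (∀ i → value π (suc i) < value π (inject₁ i)) →
                         π ≈ decreasing (suc n)
descending⇒≈decreasing {n} π π↘ i = Fin.toℕ-injective (begin
  value π i                        ≡⟨ m+n∸m≡n (toℕ i) (value π i) ⟨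
  -- The head is at most `n`, so the two bounds meet and position plus value is constantly `n`.
  toℕ i + value π i ∸ toℕ i        ≡⟨ cong (_∸ toℕ i) (≤-antisym
                                        (descending⇒upper (value π) π↘ (Fin.toℕ≤pred[n] _) i)
                                        (descending⇒lower (value π) π↘ i)) ⟩
  n ∸ toℕ i                        ≡⟨ Fin.opposite-prop i ⟨
  toℕ (opposite i)                 ∎)
  where open ≡-Reasoning

-- The value zero is attained somewhere; at a later position it would have to exceed the head.
minimum-head⇒0 : (π : Permutation′ (suc n)) → (∀ i → value π zero < value π (suc i)) →
                 π ⟨$⟩ʳ zero ≡ zero
minimum-head⇒0 π head< with π ⟨$⟩ˡ zero | inverseʳ π {zero}
... | zero  | π0≡0 = π0≡0
... | suc i | πi≡0 = contradiction (head< i) (subst (λ x → ¬ value π zero < toℕ x) (sym πi≡0) n≮0)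

tail-descending⇒≈oneThenDecreasing :
  (π : Permutation′ (suc (suc n))) → π ⟨$⟩ʳ zero ≡ zero →
  (∀ i → value π (suc (suc i)) < value π (suc (inject₁ i))) →
  π ≈ oneThenDecreasing (suc (suc n))
tail-descending⇒≈oneThenDecreasing π π0≡0 tail↘ zero    = π0≡0
tail-descending⇒≈oneThenDecreasing π π0≡0 tail↘ (suc i) =
  trans (sym (value-remove i)) (cong suc (descending⇒≈decreasing ρ ρ↘ i))
  where
  ρ = remove zero π

  value-remove : ∀ i → suc (ρ ⟨$⟩ʳ i) ≡ π ⟨$⟩ʳ suc i
  value-remove i = lift₀-remove π π0≡0 (suc i)

  ρ↘ : ∀ i → value ρ (suc i) < value ρ (inject₁ i)
  ρ↘ i = s<s⁻¹ (subst₂ Fin._<_ (sym (value-remove (suc i))) (sym (value-remove (inject₁ i))) (tail↘ i))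

-- Avoidance forces one of the two members

toℕ-suc≡suc-inject₁ : (i : Fin n) → toℕ (Fin.suc i) ≡ suc (toℕ (inject₁ i))
toℕ-suc≡suc-inject₁ i = cong suc (sym (Fin.toℕ-inject₁ i))

tail-descends :
  (π : Permutation′ (suc (suc n))) → ∀ {p₁ p₂ p₄} → p₁ ∈ A₁ → p₂ ∈ A₂ → p₄ ∈ A₄ →
  Avoids π p₁ → Avoids π p₂ → Avoids π p₄ →
  ∀ i → value π (suc (suc i)) < value π (suc (inject₁ i))
tail-descends π {p₁} {p₂} {p₄} h₁ h₂ h₄ av₁ av₂ av₄ i = descent
  where
  x = inject₁ (inject₁ i)
  y = suc (inject₁ i)
  z = suc (suc i)

  consecutive : ∀ p {v} → letters p ≡ v → OccursAt π v x y z → Contains π p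
  consecutive p eq =
    consecutive⇒contains π p eq (toℕ-suc≡suc-inject₁ (inject₁ i)) (toℕ-suc≡suc-inject₁ (suc i))

  x<z : x Fin.< z
  x<z = subst (_< toℕ z) (sym (trans (Fin.toℕ-inject₁ _) (Fin.toℕ-inject₁ i))) (m≤n⇒m≤1+n ≤-refl)

  no-ascent : ¬ value π y < value π z
  -- The value at `x` lies below, between or above the other two, giving 123, 213 or 312
  -- respectively.
  no-ascent vy<vz with <-cmp (value π x) (value π y) | <-cmp (value π x) (value π z)
  ... | tri< vx<vy _ _ | _ =
    av₁ (consecutive p₁ (A₁-letters h₁) (chain-orderIsomorphic vx<vy vy<vz (0F ∷ 1F ∷ 2F ∷ [])))
  ... | tri≈ _ vx≡vy _ | _ =
    Fin.<⇒≢ (≤-reflexive (sym (toℕ-suc≡suc-inject₁ (inject₁ i)))) (value-injective π vx≡vy)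
  ... | tri> _ _ vy<vx | tri< vx<vz _ _ =
    av₂ (consecutive p₂ (A₂-letters h₂) (chain-orderIsomorphic vy<vx vx<vz (1F ∷ 0F ∷ 2F ∷ [])))
  ... | tri> _ _ vy<vx | tri≈ _ vx≡vz _ = Fin.<⇒≢ x<z (value-injective π vx≡vz)
  ... | tri> _ _ vy<vx | tri> _ _ vz<vx =
    av₄ (consecutive p₄ (A₄-letters h₄) (chain-orderIsomorphic vy<vz vz<vx (2F ∷ 0F ∷ 1F ∷ [])))

  descent : value π z < value π y
  descent = ≤∧≢⇒< (≮⇒≥ no-ascent)
    (Fin.<⇒≢ (≤-reflexive (sym (toℕ-suc≡suc-inject₁ (suc i)))) ∘ sym ∘ value-injective π)

-- Induction along positions: a failure at one step is the first failure, so the letter just before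
-- it still exceeds the head and can play the 3 of 2-31.
first-ascent⇒minimum-head :
  (π : Permutation′ (suc (suc n))) → ∀ {p₃} → p₃ ∈ A₃ → Avoids π p₃ →
  value π zero < value π (suc zero) → ∀ i → value π zero < value π (suc i)
first-ascent⇒minimum-head {n} π h₃ av₃ v0<v1 =
  <-weakInduction (λ i → value π zero < value π (suc i)) v0<v1 step
  where
  occurs-231 : ∀ {j k} → value π zero < value π j → value π k < value π zero →
               OccursAt π (2 ∷ 3 ∷ 1 ∷ []) zero j k
  occurs-231 v0<vj vk<v0 = chain-orderIsomorphic vk<v0 v0<vj (1F ∷ 2F ∷ 0F ∷ [])

  contains : ∀ {p} → p ∈ A₃ → (i : Fin n) → value π zero < value π (suc (inject₁ i)) →
             value π (suc (suc i)) < value π zero → Contains π p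
  contains (inj₁ refl) i v0<vi vk<v0 =
    zero , suc (inject₁ i) , suc (suc i) , z<s , toℕ-suc≡suc-inject₁ (suc i) , occurs-231 v0<vi vk<v0
  contains (inj₂ refl) i v0<vi vk<v0 =
    zero , suc zero , suc (suc i) , refl , s<s z<s , occurs-231 v0<v1 vk<v0

  step : ∀ i → value π zero < value π (suc (inject₁ i)) → value π zero < value π (suc (suc i))
  step i v0<vi = ≤∧≢⇒< (≮⇒≥ (av₃ ∘ contains h₃ i v0<vi)) (Fin.<⇒≢ z<s ∘ value-injective π)

avoids⇒≈ :
  (π : Permutation′ (suc (suc n))) → ∀ {p₁ p₂ p₃ p₄} → p₁ ∈ A₁ → p₂ ∈ A₂ → p₃ ∈ A₃ → p₄ ∈ A₄ →
  S (suc (suc n)) (p₁ ∷ p₂ ∷ p₃ ∷ p₄ ∷ []) π →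
  π ≈ decreasing (suc (suc n)) ⊎ π ≈ oneThenDecreasing (suc (suc n))
avoids⇒≈ π h₁ h₂ h₃ h₄ (av₁ ∷ av₂ ∷ av₃ ∷ av₄ ∷ [])
  with tail↘ ← tail-descends π h₁ h₂ h₄ av₁ av₂ av₄
     | <-cmp (value π zero) (value π (suc zero))
... | tri< v0<v1 _ _ = inj₂ (tail-descending⇒≈oneThenDecreasing π
        (minimum-head⇒0 π (first-ascent⇒minimum-head π h₃ av₃ v0<v1)) tail↘)
... | tri≈ _ v0≡v1 _ with () ← value-injective π v0≡v1
... | tri> _ _ v1<v0 = inj₁ (descending⇒≈decreasing π λ { zero → v1<v0 ; (suc i) → tail↘ i })

-- Counting the two members

pair-cardinality : ∀ {P : Pred (Permutation′ n) 0ℓ} σ τ → ¬ σ ≈ τ →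
                   P ≐ ｛ σ , τ ｝ → HasCardinality P 2
pair-cardinality {P = P} σ τ σ≉τ (P⊆στ , στ⊆P) = record
  { to        = to
  ; from      = λ (π , Pπ) → index π (P⊆στ Pπ)
  ; to-cong   = λ { refl _ → refl }
  ; from-cong = λ {(π , Pπ)} {(ρ , Pρ)} π≈ρ → index-cong π ρ (P⊆στ Pπ) (P⊆στ Pρ) π≈ρ
  ; inverse   = (λ { {π , Pπ} refl → to-index π (P⊆στ Pπ) })
              , (λ { {s} {π , Pπ} π≈s → index-to s π (P⊆στ Pπ) π≈s })
  }
  where
  to : Fin 2 → ∃[ π ] P π
  to 0F = σ , στ⊆P (inj₁ λ _ → refl)
  to 1F = τ , στ⊆P (inj₂ λ _ → refl)

  index : ∀ π → ｛ σ , τ ｝ π → Fin 2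
  index _ (inj₁ _) = 0F
  index _ (inj₂ _) = 1F

  to-index : ∀ π (π∈ : ｛ σ , τ ｝ π) → proj₁ (to (index π π∈)) ≈ π
  to-index _ (inj₁ π≈σ) = sym ∘ π≈σ
  to-index _ (inj₂ π≈τ) = sym ∘ π≈τ

  index-to : ∀ s π (π∈ : ｛ σ , τ ｝ π) → π ≈ proj₁ (to s) → index π π∈ ≡ s
  index-to 0F _ (inj₁ _)   _   = refl
  -- Distinctness of `σ` and `τ` makes the index depend on the permutation alone, not on its
  -- membership proof.
  index-to 0F _ (inj₂ π≈τ) π≈σ = contradiction (λ i → trans (sym (π≈σ i)) (π≈τ i)) σ≉τ
  index-to 1F _ (inj₁ π≈σ) π≈τ = contradiction (λ i → trans (sym (π≈σ i)) (π≈τ i)) σ≉τ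
  index-to 1F _ (inj₂ _)   _   = refl

  index-cong : ∀ π ρ (π∈ : ｛ σ , τ ｝ π) (ρ∈ : ｛ σ , τ ｝ ρ) → π ≈ ρ →
               index π π∈ ≡ index ρ ρ∈
  index-cong π ρ π∈ ρ∈ π≈ρ =
    index-to (index ρ ρ∈) π π∈ λ i → trans (π≈ρ i) (sym (to-index ρ ρ∈ i))

decreasing≉oneThenDecreasing : ∀ n → ¬ decreasing (suc (suc n)) ≈ oneThenDecreasing (suc (suc n))
-- The heads differ: the largest index is a successor because there are at least two letters, while
-- the other head is zero.
decreasing≉oneThenDecreasing n eq with () ← eq zero

proposition2p9 : (n : ℕ) → 2 ≤ n →
    ∀ p₁ p₂ p₃ p₄ → p₁ ∈ A₁ → p₂ ∈ A₂ → p₃ ∈ A₃ → p₄ ∈ A₄ →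
    HasCardinality (S n (p₁ ∷ p₂ ∷ p₃ ∷ p₄ ∷ [])) 2
    × S n (p₁ ∷ p₂ ∷ p₃ ∷ p₄ ∷ []) ≐ ｛ decreasing n , oneThenDecreasing n ｝
proposition2p9 n@(suc (suc m)) (s≤s (s≤s z≤n)) p₁ p₂ p₃ p₄ h₁ h₂ h₃ h₄ =
  pair-cardinality (decreasing n) (oneThenDecreasing n) (decreasing≉oneThenDecreasing m) members , members
  where
  avoids : ∀ {π} → AscendsOnlyFromMinimum π → S n (p₁ ∷ p₂ ∷ p₃ ∷ p₄ ∷ []) π
  avoids {π} asc =
      ascends⇒avoids-·<· π asc p₁ (A₁-letters h₁) (n<1+n 2)
    ∷ ascends⇒avoids-·<· π asc p₂ (A₂-letters h₂) (s<s z<s)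
    ∷ ascends⇒avoids-c<a<b π asc p₃ (A₃-letters h₃) (n<1+n 2) (n<1+n 1)
    ∷ ascends⇒avoids-·<· π asc p₄ (A₄-letters h₄) (n<1+n 1)
    ∷ []

  members : S n (p₁ ∷ p₂ ∷ p₃ ∷ p₄ ∷ []) ≐ ｛ decreasing n , oneThenDecreasing n ｝
  members = (λ {π} → avoids⇒≈ π h₁ h₂ h₃ h₄)
          , λ { {π} (inj₁ π≈δ) → avoids (ascends-resp-≈ {π = π} {decreasing n} π≈δ (decreasing-ascends n))
              ; {π} (inj₂ π≈ε) → avoids (ascends-resp-≈ {π = π} {oneThenDecreasing n} π≈ε (oneThenDecreasing-ascends n)) }
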